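{- Let $u:A\rightarrow A'$ be a morphism of algebras in $\mathcal{V}$ that lifts the Boolean congruences, and let $\Omega'$ be a countable orthogonal subset of $B(Con(A'))$. Then there exists a countable orthogonal subset $\Omega$ of $B(Con(A))$ such that $u$ lifts $\Omega'$ to $\Omega$.
   Context: $\mathcal{V}$ is a congruence modular, semidegenerate variety (no nontrivial algebra has a one-element subalgebra) of finite signature, such that for every $B\in\mathcal{V}$ the set $K(B)$ of compact congruences is closed under the Freese–McKenzie commutator $[\cdot,\cdot]$. $Con(B)$ is the congruence lattice with bounds $\Delta_B,\nabla_B$; $B(Con(B))$ is the Boolean algebra of complemented elements of $Con(B)$. For a morphism $u:A\to A'$ and $\alpha\in Con(A)$, $u^{\bullet}(\alpha)$ is the congruence of $A'$ generated by $\{(u(a),u(b)):(a,b)\in\alpha\}$; $u^{\bullet}$ restricts to a Boolean morphism $B(Con(A))\to B(Con(A'))$. For $\Omega'\subseteq Con(A')$ and $\Omega\subseteq Con(A)$, $u$ lifts $\Omega'$ to $\Omega$ if $\Omega'=\{u^{\bullet}(\alpha):\alpha\in\Omega\}$; $u$ lifts the Boolean congruences if it lifts $B(Con(A'))$ to $B(Con(A))$. A subset $\Omega$ of $B(Con(A))$ is orthogonal if $\alpha\cap\beta=\Delta_A$ (equivalently $[\alpha,\beta]=\Delta_A$) for all distinct $\alpha,\beta\in\Omega$. -}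

module Defs where

open import Level using (Level; _⊔_; Lift; lift) renaming (suc to lsuc)
open import Data.Nat using (ℕ)
open import Data.Fin using (Fin)
open import Data.List using (List)
open import Data.List.Relation.Unary.Any using (Any)
open import Data.Product using (Σ; ∃; ∃₂; _×_; _,_; proj₁; proj₂)
open import Data.Sum using (_⊎_; inj₁; inj₂; [_,_]′)
open import Data.Unit using (⊤; tt)
open import Function using (_∘_; _on_)
open import Function.Bundles using (Bijection; _⇔_)
open import Relation.Nullary using (¬_)
open import Relation.Binary using (Rel; Setoid; IsEquivalence)
import Relation.Binary.Construct.On as On
open import Relation.Binary.PropositionalEquality using (setoid)

private
  variable
    ℓ p q : Level

record Signature : Set where
  field
    #ops  : ℕ
    arity : Fin #ops → ℕ

  Op : Set
  Op = Fin #ops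

open Signature public

data Term (𝒮 : Signature) (X : Set) : Set where
  var : X → Term 𝒮 X
  app : (f : Op 𝒮) → (Fin (arity 𝒮 f) → Term 𝒮 X) → Term 𝒮 X

-- Carriers are setoids, so that quotient algebras exist; as usual in universal
-- algebra, the universe of an algebra is nonempty.
record Algebra (𝒮 : Signature) (ℓ : Level) : Set (lsuc ℓ) where
  infix 4 _≈_
  field
    Carrier       : Set ℓ
    _≈_           : Rel Carrier ℓ
    isEquivalence : IsEquivalence _≈_
    op            : (f : Op 𝒮) → (Fin (arity 𝒮 f) → Carrier) → Carrier
    op-cong       : (f : Op 𝒮) {xs ys : Fin (arity 𝒮 f) → Carrier} →
                    (∀ i → xs i ≈ ys i) → op f xs ≈ op f ys
    nonempty      : Carrier

  module ≈ = IsEquivalence isEquivalence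

  eval : {X : Set} → (X → Carrier) → Term 𝒮 X → Carrier
  eval ρ (var x)    = ρ x
  eval ρ (app f ts) = op f (λ i → eval ρ (ts i))

-- A variety is presented as an equational class, by its set of identities.
Variety : Signature → (ℓ : Level) → Set (lsuc ℓ)
Variety 𝒮 ℓ = Term 𝒮 ℕ → Term 𝒮 ℕ → Set ℓ

infix 4 _∈ᵥ_

_∈ᵥ_ : {𝒮 : Signature} → Algebra 𝒮 ℓ → Variety 𝒮 ℓ → Set ℓ
A ∈ᵥ 𝒱 = ∀ {s t} → 𝒱 s t → (ρ : ℕ → Carrier) → eval ρ s ≈ eval ρ t
  where open Algebra A

record Hom {𝒮 : Signature} (A B : Algebra 𝒮 ℓ) : Set ℓ where
  private
    module A = Algebra A
    module B = Algebra B
  field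
    map      : A.Carrier → B.Carrier
    map-cong : ∀ {x y} → x A.≈ y → map x B.≈ map y
    map-op   : ∀ f xs → map (A.op f xs) B.≈ B.op f (map ∘ xs)

record Subuniverse {𝒮 : Signature} (A : Algebra 𝒮 ℓ) : Set (lsuc ℓ) where
  open Algebra A
  field
    mem      : Carrier → Set ℓ
    mem-resp : ∀ {x y} → x ≈ y → mem x → mem y
    closed   : ∀ f xs → (∀ i → mem (xs i)) → mem (op f xs)

  OneElement : Set ℓ
  OneElement = ∃ λ x → mem x × (∀ {y} → mem y → y ≈ x)

Trivial : {𝒮 : Signature} → Algebra 𝒮 ℓ → Set ℓ
Trivial A = ∀ x y → x ≈ y
  where open Algebra A

record Con {𝒮 : Signature} (A : Algebra 𝒮 ℓ) : Set (lsuc ℓ) where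
  open Algebra A using (Carrier; _≈_; op)
  field
    rel       : Rel Carrier ℓ
    ≈⇒rel     : ∀ {x y} → x ≈ y → rel x y
    rel-sym   : ∀ {x y} → rel x y → rel y x
    rel-trans : ∀ {x y z} → rel x y → rel y z → rel x z
    rel-op    : ∀ f {xs ys} → (∀ i → rel (xs i) (ys i)) → rel (op f xs) (op f ys)

module _ {𝒮 : Signature} {A : Algebra 𝒮 ℓ} where
  open Algebra A using (Carrier; _≈_; op; op-cong; eval; module ≈)
  open Con

  infix 4 _⊑_ _≐_
  infixr 7 _∩_
  infixr 6 _∨_

  _⊑_ : Con A → Con A → Set ℓ
  α ⊑ β = ∀ {x y} → rel α x y → rel β x y

  _≐_ : Con A → Con A → Set ℓ
  α ≐ β = (α ⊑ β) × (β ⊑ α)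

  ≐-isEquivalence : IsEquivalence _≐_
  ≐-isEquivalence = record
    { refl  = (λ r → r) , (λ r → r)
    ; sym   = λ (f , g) → g , f
    ; trans = λ (f , g) (h , k) → (λ r → h (f r)) , (λ r → g (k r))
    }

  Δ : Con A
  Δ = record
    { rel       = _≈_
    ; ≈⇒rel     = λ r → r
    ; rel-sym   = ≈.sym
    ; rel-trans = ≈.trans
    ; rel-op    = op-cong
    }

  ∇ : Con A
  ∇ = record
    { rel       = λ _ _ → Lift ℓ ⊤
    ; ≈⇒rel     = λ _ → lift tt
    ; rel-sym   = λ _ → lift tt
    ; rel-trans = λ _ _ → lift tt
    ; rel-op    = λ _ _ → lift tt
    }

  _∩_ : Con A → Con A → Con A
  α ∩ β = record
    { rel       = λ x y → rel α x y × rel β x y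
    ; ≈⇒rel     = λ r → ≈⇒rel α r , ≈⇒rel β r
    ; rel-sym   = λ (r , s) → rel-sym α r , rel-sym β s
    ; rel-trans = λ (r , s) (r′ , s′) → rel-trans α r r′ , rel-trans β s s′
    ; rel-op    = λ f rs → rel-op α f (proj₁ ∘ rs) , rel-op β f (proj₂ ∘ rs)
    }

  data Gen (R : Rel Carrier ℓ) : Rel Carrier ℓ where
    gen   : ∀ {x y} → R x y → Gen R x y
    incl  : ∀ {x y} → x ≈ y → Gen R x y
    symm  : ∀ {x y} → Gen R x y → Gen R y x
    trns  : ∀ {x y z} → Gen R x y → Gen R y z → Gen R x z
    congr : ∀ f {xs ys} → (∀ i → Gen R (xs i) (ys i)) → Gen R (op f xs) (op f ys)

  Cg : Rel Carrier ℓ → Con A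
  Cg R = record
    { rel       = Gen R
    ; ≈⇒rel     = incl
    ; rel-sym   = symm
    ; rel-trans = trns
    ; rel-op    = congr
    }

  Cg-least : ∀ {R} (γ : Con A) → (∀ {x y} → R x y → rel γ x y) → Cg R ⊑ γ
  Cg-least γ h (gen r)      = h r
  Cg-least γ h (incl r)     = ≈⇒rel γ r
  Cg-least γ h (symm r)     = rel-sym γ (Cg-least γ h r)
  Cg-least γ h (trns r s)   = rel-trans γ (Cg-least γ h r) (Cg-least γ h s)
  Cg-least γ h (congr f rs) = rel-op γ f (λ i → Cg-least γ h (rs i))

  _∨_ : Con A → Con A → Con A
  α ∨ β = Cg (λ x y → rel α x y ⊎ rel β x y)

  ⋁ : {I : Set ℓ} → (I → Con A) → Con A
  ⋁ θ = Cg (λ x y → ∃ λ i → rel (θ i) x y)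

  ⋁-finite : {I : Set ℓ} → (I → Con A) → List I → Con A
  ⋁-finite θ is = Cg (λ x y → Any (λ i → rel (θ i) x y) is)

  Compact : Con A → Set (lsuc ℓ)
  Compact α = {I : Set ℓ} (θ : I → Con A) → α ⊑ ⋁ θ → ∃ λ is → α ⊑ ⋁-finite θ is

  IsComplement : Con A → Con A → Set ℓ
  IsComplement α β = (α ∩ β ≐ Δ) × (α ∨ β ≐ ∇)

  Complemented : Con A → Set (lsuc ℓ)
  Complemented α = ∃ λ β → IsComplement α β

  -- C(α, β; δ): for each matrix
  --     t(a , b)   t(a , b′)
  --     t(a′, b)   t(a′, b′)
  -- in M(α, β), if the entries of the first row are δ-related, then so are
  -- those of the second.
  Centralizes : Con A → Con A → Con A → Set ℓ
  Centralizes α β δ =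
    ∀ {m n} (t : Term 𝒮 (Fin m ⊎ Fin n)) {a a′ : Fin m → Carrier} {b b′ : Fin n → Carrier} →
    (∀ i → rel α (a i) (a′ i)) → (∀ j → rel β (b j) (b′ j)) →
    rel δ (eval [ a  , b ]′ t) (eval [ a  , b′ ]′ t) →
    rel δ (eval [ a′ , b ]′ t) (eval [ a′ , b′ ]′ t)

  -- The Freese–McKenzie commutator [ α , β ] is the least δ with C(α, β; δ).
  -- It is generated inductively, since intersecting all such δ would raise the
  -- universe level; see commutator-centralizes and commutator-least.
  data Comm (α β : Con A) : Rel Carrier ℓ where
    incl  : ∀ {x y} → x ≈ y → Comm α β x y
    symm  : ∀ {x y} → Comm α β x y → Comm α β y x
    trns  : ∀ {x y z} → Comm α β x y → Comm α β y z → Comm α β x z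
    congr : ∀ f {xs ys} → (∀ i → Comm α β (xs i) (ys i)) → Comm α β (op f xs) (op f ys)
    centr : ∀ {m n} (t : Term 𝒮 (Fin m ⊎ Fin n)) {a a′ : Fin m → Carrier} {b b′ : Fin n → Carrier} →
            (∀ i → rel α (a i) (a′ i)) → (∀ j → rel β (b j) (b′ j)) →
            Comm α β (eval [ a  , b ]′ t) (eval [ a  , b′ ]′ t) →
            Comm α β (eval [ a′ , b ]′ t) (eval [ a′ , b′ ]′ t)

  [_,_] : Con A → Con A → Con A
  [ α , β ] = record
    { rel       = Comm α β
    ; ≈⇒rel     = incl
    ; rel-sym   = symm
    ; rel-trans = trns
    ; rel-op    = congr
    }

  commutator-centralizes : ∀ α β → Centralizes α β [ α , β ]
  commutator-centralizes α β = centr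

  commutator-least : ∀ α β δ → Centralizes α β δ → [ α , β ] ⊑ δ
  commutator-least α β δ C (incl r)        = ≈⇒rel δ r
  commutator-least α β δ C (symm r)        = rel-sym δ (commutator-least α β δ C r)
  commutator-least α β δ C (trns r s)      =
    rel-trans δ (commutator-least α β δ C r) (commutator-least α β δ C s)
  commutator-least α β δ C (congr f rs)    = rel-op δ f (λ i → commutator-least α β δ C (rs i))
  commutator-least α β δ C (centr t p q r) = C t p q (commutator-least α β δ C r)

module _ {𝒮 : Signature} (𝒱 : Variety 𝒮 ℓ) where

  CongruenceModular : Set (lsuc ℓ)
  CongruenceModular = (B : Algebra 𝒮 ℓ) → B ∈ᵥ 𝒱 → (α β γ : Con B) →
    α ⊑ γ → (α ∨ β) ∩ γ ≐ α ∨ (β ∩ γ)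

  -- "No nontrivial algebra has a one-element subalgebra", in positive form.
  Semidegenerate : Set (lsuc ℓ)
  Semidegenerate = (B : Algebra 𝒮 ℓ) → B ∈ᵥ 𝒱 → (S : Subuniverse B) →
    Subuniverse.OneElement S → Trivial B

  CompactClosedUnderCommutator : Set (lsuc ℓ)
  CompactClosedUnderCommutator = (B : Algebra 𝒮 ℓ) → B ∈ᵥ 𝒱 → (α β : Con B) →
    Compact α → Compact β → Compact [ α , β ]

record ConSubset {𝒮 : Signature} (A : Algebra 𝒮 ℓ) (p : Level) : Set (lsuc (ℓ ⊔ p)) where
  field
    mem      : Con A → Set p
    mem-resp : ∀ {α β} → α ≐ β → mem α → mem β

  Elements : Setoid (lsuc ℓ ⊔ p) ℓ
  Elements = record
    { Carrier       = Σ (Con A) mem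
    ; _≈_           = _≐_ on proj₁
    ; isEquivalence = On.isEquivalence proj₁ ≐-isEquivalence
    }

module _ {𝒮 : Signature} {A : Algebra 𝒮 ℓ} where
  open ConSubset

  infix 4 _∈_ _⊆_

  _∈_ : Con A → ConSubset A p → Set p
  α ∈ Ω = mem Ω α

  _⊆_ : ConSubset A p → ConSubset A q → Set (lsuc ℓ ⊔ p ⊔ q)
  Ω ⊆ Ψ = ∀ {α} → α ∈ Ω → α ∈ Ψ

  Orthogonal : ConSubset A p → Set (lsuc ℓ ⊔ p)
  Orthogonal Ω = ∀ {α β} → α ∈ Ω → β ∈ Ω → ¬ (α ≐ β) → α ∩ β ≐ Δ

  -- Elements are counted up to ≐; the enumeration has no repetitions.
  Countable : ConSubset A p → Set (lsuc ℓ ⊔ p)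
  Countable Ω = (∃ λ n → Bijection (setoid (Fin n)) (Elements Ω))
              ⊎ Bijection (setoid ℕ) (Elements Ω)

B[Con_] : {𝒮 : Signature} (A : Algebra 𝒮 ℓ) → ConSubset A (lsuc ℓ)
B[Con A ] = record
  { mem      = Complemented
  ; mem-resp = λ { {β = β} (α⊑β , β⊑α) (γ , (d , d′) , (_ , n)) → γ
      , ((λ (r , s) → d (β⊑α r , s)) , (λ r → let (x , y) = d′ r in α⊑β x , y))
      , ((λ _ → lift tt)
        , λ r → Cg-least (β ∨ γ) (λ { (inj₁ x) → gen (inj₁ (α⊑β x)) ; (inj₂ y) → gen (inj₂ y) }) (n r)) }
  }

module _ {𝒮 : Signature} {A A′ : Algebra 𝒮 ℓ} (u : Hom A A′) where
  open Hom u
  open Algebra A′ using (_≈_)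

  -- push u α is the congruence written u•(α).
  push : Con A → Con A′
  push α = Cg (λ x y → ∃₂ λ a b → Con.rel α a b × x ≈ map a × y ≈ map b)

  Lifts : ConSubset A′ p → ConSubset A q → Set (lsuc ℓ ⊔ p ⊔ q)
  Lifts Ω′ Ω = ∀ β → β ∈ Ω′ ⇔ (∃ λ α → α ∈ Ω × β ≐ push α)

  LiftsBooleanCongruences : Set (lsuc ℓ)
  LiftsBooleanCongruences = Lifts B[Con A′ ] B[Con A ]

{-# OPTIONS --safe #-}

-- Centrality C(α, β; δ) is treated through the congruence Cent β δ, obtained by
-- pulling back along the diagonal the largest congruence of A(β) = β ≤ A² that
-- preserves δ-related rows.  Gumm's Shifting Lemma in A(β) makes centrality
-- symmetric in α, β and monotone in δ.  Semidegeneracy gives γ ≤ δ when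
-- C(∇, γ; δ), whence γ = (γ ∩ α) ∨ (γ ∩ β) if α ∨ β = ∇: this is all the
-- distributivity that the Boolean algebra of complemented congruences needs.
-- That u• preserves complements rests on the compactness of the commutator of
-- two principal congruences in a free algebra.  Finally, if the αᵢ lift an
-- enumeration of Ω′, then so do the orthogonal αᵢ ∩ ⋂ { ¬ αⱼ | j < i }.
module Submission where

open import Level using (Level; Lift; lift)
open import Data.Empty using (⊥-elim)
open import Data.Fin using (Fin; zero; suc; _↑ˡ_; _↑ʳ_; splitAt)
import Data.Fin as Fin
import Data.Fin.Properties as Fin
open import Data.List using (List; []; _∷_; _++_; concat; tabulate; foldr; filter; allFin; upTo)
open import Data.List.Membership.Propositional using () renaming (_∈_ to _∈ˡ_)
open import Data.List.Membership.Propositional.Properties using (∈-filter⁺; ∈-filter⁻; ∈-allFin; ∈-upTo⁺; ∈-upTo⁻)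
open import Data.List.Relation.Unary.Any using (Any; here; there)
import Data.List.Relation.Unary.Any.Properties as Any
open import Data.Nat using (ℕ; zero; suc; _≤_; _<_; _<?_; _⊔_; _+_)
open import Data.Nat.Properties using (≤-refl; ≤-trans; <-≤-trans; <-irrefl; <-cmp; m≤m⊔n; m≤n⊔m)
open import Data.Product using (Σ; ∃; ∃₂; _×_; _,_; proj₁; proj₂)
open import Data.Sum using (_⊎_; inj₁; inj₂; [_,_]′)
open import Data.Unit using (tt)
import Data.Vec as Vec
open import Data.Vec.Functional using (Vector; updateAt) renaming (_∷_ to _∷ᶠ_; _++_ to _++ᶠ_)
open import Data.Vec.Functional.Properties using (lookup-++ˡ; lookup-++ʳ)
open import Function using (_∘_; const; id)
open import Function.Bundles using (Bijection; Equivalence; mk⇔)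
open import Relation.Binary using (Rel; IsEquivalence; tri<; tri≈; tri>)
open import Relation.Binary.PropositionalEquality using (_≡_; refl; sym; setoid)
open import Relation.Nullary using (¬_; yes; no)
open import Defs

private
  variable
    ℓ p : Level
    𝒮 : Signature

open Con
open Hom

-- Changing one entry of a tuple

infixl 9 _[_≔_]

_[_≔_] : ∀ {a} {X : Set a} {n} → Vector X n → Fin n → X → Vector X n
xs [ i ≔ x ] = updateAt xs i (const x)

≔-pointwise : ∀ {a b r} {X : Set a} {Y : Set b} (R : X → Y → Set r) {n}
  {xs : Vector X n} {ys : Vector Y n} {x y} (i : Fin n) →
  (∀ j → R (xs j) (ys j)) → R x y → ∀ j → R ((xs [ i ≔ x ]) j) ((ys [ i ≔ y ]) j)
≔-pointwise R zero    rs r zero    = r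
≔-pointwise R zero    rs r (suc j) = rs (suc j)
≔-pointwise R (suc i) rs r zero    = rs zero
≔-pointwise R (suc i) rs r (suc j) = ≔-pointwise R i (rs ∘ suc) r j

-- The entries are changed one at a time and the steps chained by transitivity. Tuples are functions
-- without extensionality, so `g` is asked separately to respect pointwise equality.
≔-induction : ∀ {a b r s} {X : Set a} {Y : Set b} {S : X → X → Set s} (R : Y → Y → Set r) →
  (∀ {x y z} → R x y → R y z → R x z) →
  ∀ {n} (g : Vector X n → Y) →
  (∀ {xs ys} → (∀ i → xs i ≡ ys i) → R (g xs) (g ys)) →
  (∀ xs i {x y} → S x y → R (g (xs [ i ≔ x ])) (g (xs [ i ≔ y ]))) →
  ∀ {xs ys} → (∀ i → S (xs i) (ys i)) → R (g xs) (g ys)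
≔-induction R tr {zero} g g-≗ g-≔ rs = g-≗ λ ()
≔-induction {S = S} R tr {suc n} g g-≗ g-≔ {xs} {ys} rs =
  tr (g-≗ λ { zero → refl ; (suc i) → refl })
    (tr (≔-induction {S = S} R tr (λ zs → g (xs zero ∷ᶠ zs))
          (λ eq → g-≗ λ { zero → refl ; (suc i) → eq i })
          (λ zs i r → tr (g-≗ λ { zero → refl ; (suc j) → refl })
            (tr (g-≔ (xs zero ∷ᶠ zs) (suc i) r) (g-≗ λ { zero → refl ; (suc j) → refl })))
          (rs ∘ suc))
    (tr (g-≗ λ { zero → refl ; (suc i) → refl })
    (tr (g-≔ ys zero (rs zero))
      (g-≗ λ { zero → refl ; (suc i) → refl }))))

-- Homomorphisms, pullbacks, quotients

module _ {A : Algebra 𝒮 ℓ} where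
  open Algebra A

  rel-refl : (α : Con A) → ∀ {x} → rel α x x
  rel-refl α = ≈⇒rel α ≈.refl

  rel-≈ : (α : Con A) → ∀ {x y x′ y′} → x ≈ x′ → y ≈ y′ → rel α x y → rel α x′ y′
  rel-≈ α p q r = rel-trans α (≈⇒rel α (≈.sym p)) (rel-trans α r (≈⇒rel α q))

  rel-eval : (α : Con A) {X : Set} {ρ σ : X → Carrier} →
    (∀ x → rel α (ρ x) (σ x)) → ∀ t → rel α (eval ρ t) (eval σ t)
  rel-eval α h (var x)    = h x
  rel-eval α h (app f ts) = rel-op α f (λ i → rel-eval α h (ts i))

  ∨-least : {α β γ : Con A} → α ⊑ γ → β ⊑ γ → α ∨ β ⊑ γ
  ∨-least {γ = γ} h k = Cg-least γ λ { (inj₁ r) → h r ; (inj₂ r) → k r }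

hom-eval : {A B : Algebra 𝒮 ℓ} (h : Hom A B) {X : Set} (ρ : X → Algebra.Carrier A) (t : Term 𝒮 X) →
  Algebra._≈_ B (map h (Algebra.eval A ρ t)) (Algebra.eval B (map h ∘ ρ) t)
hom-eval {B = B} h ρ (var x)    = Algebra.≈.refl B
hom-eval {B = B} h ρ (app f ts) =
  Algebra.≈.trans B (map-op h f _) (Algebra.op-cong B f (λ i → hom-eval h ρ (ts i)))

pull : {A B : Algebra 𝒮 ℓ} → Hom A B → Con B → Con A
pull {B = B} h β = record
  { rel       = λ x y → rel β (map h x) (map h y)
  ; ≈⇒rel     = λ r → ≈⇒rel β (map-cong h r)
  ; rel-sym   = rel-sym β
  ; rel-trans = rel-trans β
  ; rel-op    = λ f rs → rel-≈ β (Algebra.≈.sym B (map-op h f _)) (Algebra.≈.sym B (map-op h f _)) (rel-op β f rs)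
  }

ker : {A B : Algebra 𝒮 ℓ} → Hom A B → Con A
ker h = pull h Δ

quotient : (A : Algebra 𝒮 ℓ) → Con A → Algebra 𝒮 ℓ
quotient A θ = record
  { Carrier       = Carrier
  ; _≈_           = rel θ
  ; isEquivalence = record { refl = rel-refl θ ; sym = rel-sym θ ; trans = rel-trans θ }
  ; op            = op
  ; op-cong       = rel-op θ
  ; nonempty      = nonempty
  }
  where open Algebra A

projection : {A : Algebra 𝒮 ℓ} (θ : Con A) → Hom A (quotient A θ)
projection θ = record { map = id ; map-cong = ≈⇒rel θ ; map-op = λ f xs → rel-refl θ }

quotient-∈ᵥ : {𝒱 : Variety 𝒮 ℓ} {A : Algebra 𝒮 ℓ} (θ : Con A) → A ∈ᵥ 𝒱 → quotient A θ ∈ᵥ 𝒱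
quotient-∈ᵥ θ A∈ {s} {t} e ρ = rel-trans θ (rel-sym θ (hom-eval (projection θ) ρ s))
  (rel-trans θ (≈⇒rel θ (A∈ e ρ)) (hom-eval (projection θ) ρ t))

correspondence : {A B : Algebra 𝒮 ℓ} (π : Hom A B) (s : Algebra.Carrier B → Algebra.Carrier A) →
  (∀ y → Algebra._≈_ B (map π (s y)) y) → (ζ : Con A) → ker π ⊑ ζ →
  {R : Rel (Algebra.Carrier B) ℓ} →
  (∀ {v w} → R v w → ∃₂ λ x y → rel ζ x y × Algebra._≈_ B v (map π x) × Algebra._≈_ B w (map π y)) →
  pull π (Cg R) ⊑ ζ
correspondence {A = A} {B} π s πs ζ ker⊑ζ {R} h {x} {y} r =
  rel-trans ζ (ker⊑ζ (≈.sym (πs (map π x))))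
    (rel-trans ζ (Cg-least image image-gen r) (ker⊑ζ (πs (map π y))))
  where
  open Algebra B
  s-op : ∀ f xs → map π (s (op f xs)) ≈ map π (Algebra.op A f (s ∘ xs))
  s-op f xs = ≈.trans (πs _) (≈.trans (op-cong f (λ i → ≈.sym (πs (xs i)))) (≈.sym (map-op π f _)))
  image : Con B
  image = record
    { rel       = λ x y → rel ζ (s x) (s y)
    ; ≈⇒rel     = λ e → ker⊑ζ (≈.trans (πs _) (≈.trans e (≈.sym (πs _))))
    ; rel-sym   = rel-sym ζ
    ; rel-trans = rel-trans ζ
    ; rel-op    = λ f {xs} {ys} rs → rel-trans ζ (ker⊑ζ (s-op f xs))
        (rel-trans ζ (rel-op ζ f rs) (rel-sym ζ (ker⊑ζ (s-op f ys))))
    }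
  image-gen : ∀ {v w} → R v w → rel ζ (s v) (s w)
  image-gen r with h r
  ... | x , y , z , v≈ , w≈ = rel-trans ζ (ker⊑ζ (≈.trans (πs _) v≈))
    (rel-trans ζ z (rel-sym ζ (ker⊑ζ (≈.trans (πs _) w≈))))

-- The largest congruence contained in an equivalence relation

module _ (B : Algebra 𝒮 ℓ) where
  open Algebra B

  -- Basic unary polynomials, innermost operation first. The largest congruence inside an
  -- equivalence identifies the elements that no translation separates.
  data Translation : Set ℓ where
    hole : Translation
    step : (f : Op 𝒮) → Fin (arity 𝒮 f) → (Fin (arity 𝒮 f) → Carrier) → Translation → Translation

  translate : Translation → Carrier → Carrier
  translate hole            z = z
  translate (step f i xs τ) z = translate τ (op f (xs [ i ≔ z ]))

  translate-compatible : ∀ {t} (T : Rel Carrier t) → (∀ x → T x x) →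
    (∀ f {xs ys} → (∀ i → T (xs i) (ys i)) → T (op f xs) (op f ys)) →
    ∀ τ {x y} → T x y → T (translate τ x) (translate τ y)
  translate-compatible T T-refl T-op hole r = r
  translate-compatible T T-refl T-op (step f i xs τ) r =
    translate-compatible T T-refl T-op τ (T-op f (≔-pointwise T i (λ j → T-refl (xs j)) r))

module _ {B : Algebra 𝒮 ℓ} {E : Rel (Algebra.Carrier B) ℓ} (E-equiv : IsEquivalence E)
  (≈⇒E : ∀ {x y} → Algebra._≈_ B x y → E x y) where
  open Algebra B
  private module E = IsEquivalence E-equiv

  largest : Con B
  largest = record
    { rel       = largestRel
    ; ≈⇒rel     = ≈⇒largest
    ; rel-sym   = λ r τ → E.sym (r τ)
    ; rel-trans = λ r s τ → E.trans (r τ) (s τ)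
    -- Changing a single argument of `f` is absorbed as one more translation step.
    ; rel-op    = λ f → ≔-induction {S = largestRel} largestRel (λ r s τ → E.trans (r τ) (s τ)) (op f)
        (λ eq → ≈⇒largest (op-cong f (λ i → ≈.reflexive (eq i))))
        (λ xs i r τ → r (step f i xs τ))
    }
    where
    largestRel : Rel Carrier ℓ
    largestRel x y = ∀ τ → E (translate B τ x) (translate B τ y)
    ≈⇒largest : ∀ {x y} → x ≈ y → largestRel x y
    ≈⇒largest r τ = ≈⇒E (translate-compatible B _≈_ (λ _ → ≈.refl) op-cong τ r)

-- The subalgebra of A × A given by a congruence

module _ {A : Algebra 𝒮 ℓ} where
  open Algebra A

  pairs : Con A → Algebra 𝒮 ℓ
  pairs β = record
    { Carrier       = Σ (Carrier × Carrier) λ (x , y) → rel β x y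
    ; _≈_           = λ ((x , y) , _) ((x′ , y′) , _) → x ≈ x′ × y ≈ y′
    ; isEquivalence = record
      { refl  = ≈.refl , ≈.refl
      ; sym   = λ (p , q) → ≈.sym p , ≈.sym q
      ; trans = λ (p , q) (p′ , q′) → ≈.trans p p′ , ≈.trans q q′
      }
    ; op            = λ f xs → (op f (proj₁ ∘ proj₁ ∘ xs) , op f (proj₂ ∘ proj₁ ∘ xs)) , rel-op β f (proj₂ ∘ xs)
    ; op-cong       = λ f rs → op-cong f (proj₁ ∘ rs) , op-cong f (proj₂ ∘ rs)
    ; nonempty      = (nonempty , nonempty) , rel-refl β
    }

  module _ (β : Con A) where

    π₀ : Hom (pairs β) A
    π₀ = record { map = proj₁ ∘ proj₁ ; map-cong = proj₁ ; map-op = λ f xs → ≈.refl }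

    π₁ : Hom (pairs β) A
    π₁ = record { map = proj₂ ∘ proj₁ ; map-cong = proj₂ ; map-op = λ f xs → ≈.refl }

    diagonal : Hom A (pairs β)
    diagonal = record
      { map      = λ x → (x , x) , rel-refl β
      ; map-cong = λ r → r , r
      ; map-op   = λ f xs → ≈.refl , ≈.refl
      }

    pairs-∈ᵥ : {𝒱 : Variety 𝒮 ℓ} → A ∈ᵥ 𝒱 → pairs β ∈ᵥ 𝒱
    pairs-∈ᵥ A∈ {s} {t} e ρ =
        ≈.trans (hom-eval π₀ ρ s) (≈.trans (A∈ e _) (≈.sym (hom-eval π₀ ρ t)))
      , ≈.trans (hom-eval π₁ ρ s) (≈.trans (A∈ e _) (≈.sym (hom-eval π₁ ρ t)))

  module _ (β δ : Con A) where

    -- An element of A(β) is seen as a row of a matrix. `Transfer` is then the syntactic congruence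
    -- of the subset δ ∩ β of A(β).
    SameRow : Rel (Algebra.Carrier (pairs β)) ℓ
    SameRow ((x , y) , _) ((x′ , y′) , _) = (rel δ x y → rel δ x′ y′) × (rel δ x′ y′ → rel δ x y)

    Transfer : Con (pairs β)
    Transfer = largest {B = pairs β} {E = SameRow}
      (record
        { refl  = id , id
        ; sym   = λ (f , g) → g , f
        ; trans = λ (f , g) (f′ , g′) → f′ ∘ f , g ∘ g′
        })
      (λ (p , q) → rel-≈ δ p q , rel-≈ δ (≈.sym p) (≈.sym q))

    -- The centralizer of β modulo δ: the largest α such that C(α, β; δ).
    Cent : Con A
    Cent = pull (diagonal β) Transfer

    Transfer⊆ : ∀ {P Q} → rel Transfer P Q → SameRow P Q
    Transfer⊆ r = r hole

    -- Translations preserve every reflexive compatible relation, so `T` can be tested as it is,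
    -- without passing to its transitive closure.
    Transfer-greatest : ∀ {t} (T : Rel (Algebra.Carrier (pairs β)) t) → (∀ P → T P P) →
      (∀ f {Ps Qs} → (∀ i → T (Ps i) (Qs i)) → T (Algebra.op (pairs β) f Ps) (Algebra.op (pairs β) f Qs)) →
      (∀ {P Q} → T P Q → SameRow P Q) → ∀ {P Q} → T P Q → rel Transfer P Q
    Transfer-greatest T T-refl T-op T⊆ r τ = T⊆ (translate-compatible (pairs β) T T-refl T-op τ r)

    -- If x δ y, and x′, y′ are α-related to x, y, then x′ α x δ y α y′ puts the β-pair (x′ , y′) in
    -- β ∩ (α ∨ δ).
    ⊑Cent : (α : Con A) → β ∩ (α ∨ δ) ⊑ δ → α ⊑ Cent
    ⊑Cent α h {x} {y} r = Transfer-greatest T (λ _ → rel-refl α , rel-refl α)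
      (λ f rs → rel-op α f (proj₁ ∘ rs) , rel-op α f (proj₂ ∘ rs))
      (λ {P} {Q} (r , s) → T-row {P} {Q} r s , T-row {Q} {P} (rel-sym α r) (rel-sym α s))
      {map (diagonal β) x} {map (diagonal β) y} (r , r)
      where
      T : Rel (Algebra.Carrier (pairs β)) ℓ
      T ((x , y) , _) ((x′ , y′) , _) = rel α x x′ × rel α y y′
      T-row : ∀ {P Q : Algebra.Carrier (pairs β)} → let ((x , y) , _) = P ; ((x′ , y′) , _) = Q in
        rel α x x′ → rel α y y′ → rel δ x y → rel δ x′ y′
      T-row {P} {_ , q} r s d =
        h (q , trns (gen (inj₁ (rel-sym α r))) (trns (gen (inj₂ d)) (gen (inj₁ s))))

  rename : ∀ {X Y : Set} → (X → Y) → Term 𝒮 X → Term 𝒮 Y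
  rename g (var x)    = var (g x)
  rename g (app f ts) = app f (λ i → rename g (ts i))

  eval-rename : ∀ {X Y : Set} (g : X → Y) {ρ : X → Carrier} {σ : Y → Carrier} →
    (∀ x → ρ x ≈ σ (g x)) → ∀ t → eval ρ t ≈ eval σ (rename g t)
  eval-rename g h (var x)    = h x
  eval-rename g h (app f ts) = op-cong f (λ i → eval-rename g h (ts i))

  -- By induction on the translation, the images of the two diagonal pairs remain the rows of a
  -- matrix in M(α, β).
  Centralizes⇒⊑Cent : (α β δ : Con A) → Centralizes α β δ → α ⊑ Cent β δ
  Centralizes⇒⊑Cent α β δ C {x} {y} r τ =
    -- The initial matrix has rows (x , x) and (y , y): one α-variable and no β-variable.
    row τ {1} {0} (var (inj₁ zero)) {λ _ → x} {λ _ → y} {λ ()} {λ ()} (λ _ → r) (λ ())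
      {map (diagonal β) x} {map (diagonal β) y}
      (≈.refl , ≈.refl) (≈.refl , ≈.refl)
    where
    open Algebra (pairs β) using () renaming (Carrier to Pair; _≈_ to _≈ₚ_)
    row : ∀ τ {m n} (t : Term 𝒮 (Fin m ⊎ Fin n)) {a a′ : Fin m → Carrier} {b b′ : Fin n → Carrier} →
      (∀ i → rel α (a i) (a′ i)) → (∀ j → rel β (b j) (b′ j)) →
      ∀ {P Q : Pair} →
      (proj₁ (proj₁ P) ≈ eval [ a , b ]′ t) × (proj₂ (proj₁ P) ≈ eval [ a , b′ ]′ t) →
      (proj₁ (proj₁ Q) ≈ eval [ a′ , b ]′ t) × (proj₂ (proj₁ Q) ≈ eval [ a′ , b′ ]′ t) →
      SameRow β δ (translate (pairs β) τ P) (translate (pairs β) τ Q)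
    row hole t aα bβ (p , p′) (q , q′) =
        (λ d → rel-≈ δ (≈.sym q) (≈.sym q′) (C t aα bβ (rel-≈ δ p p′ d)))
      , (λ d → rel-≈ δ (≈.sym p) (≈.sym p′) (C t (rel-sym α ∘ aα) bβ (rel-≈ δ q q′ d)))
    row (step f i xs τ) {m} {n} t {a} {a′} {b} {b′} aα bβ (p , p′) (q , q′) =
      -- The other arguments of `f` are β-pairs, so their coordinates become `k` further
      -- β-variables, appended to the old ones.
      row τ (app f (vars [ i ≔ rename weaken t ])) {a} {a′} {b ++ᶠ c} {b′ ++ᶠ c′} aα bcβ
        (op-cong f (entry (proj₁ ∘ proj₁) p) , op-cong f (entry (proj₂ ∘ proj₁) p′))
        (op-cong f (entry (proj₁ ∘ proj₁) q) , op-cong f (entry (proj₂ ∘ proj₁) q′))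
      where
      c  = proj₁ ∘ proj₁ ∘ xs
      c′ = proj₂ ∘ proj₁ ∘ xs
      k  = arity 𝒮 f
      weaken : Fin m ⊎ Fin n → Fin m ⊎ Fin (n + k)
      weaken (inj₁ i) = inj₁ i
      weaken (inj₂ j) = inj₂ (j ↑ˡ k)
      vars : Fin k → Term 𝒮 (Fin m ⊎ Fin (n + k))
      vars j = var (inj₂ (n ↑ʳ j))
      bcβ : ∀ j → rel β ((b ++ᶠ c) j) ((b′ ++ᶠ c′) j)
      bcβ j with splitAt n j
      ... | inj₁ j = bβ j
      ... | inj₂ j = proj₂ (xs j)
      entry : (π : Pair → Carrier) {P : Pair} {a : Fin m → Carrier} {b : Fin n → Carrier} →
        π P ≈ eval [ a , b ]′ t →
        ∀ j → π ((xs [ i ≔ P ]) j) ≈ eval [ a , b ++ᶠ (π ∘ xs) ]′ ((vars [ i ≔ rename weaken t ]) j)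
      entry π {P} {a} {b} e = ≔-pointwise (λ P t → π P ≈ eval [ a , b ++ᶠ (π ∘ xs) ]′ t) i
        (λ j → ≈.reflexive (sym (lookup-++ʳ b (π ∘ xs) j)))
        (≈.trans e (eval-rename weaken
          (λ { (inj₁ i) → ≈.refl ; (inj₂ j) → ≈.reflexive (sym (lookup-++ˡ b (π ∘ xs) j)) }) t))

  commutator⊑∩ : (α β : Con A) → [ α , β ] ⊑ α ∩ β
  commutator⊑∩ α β = commutator-least α β (α ∩ β) λ t aα bβ (r , _) →
      rel-trans α (rel-sym α (rel-eval α (λ { (inj₁ i) → aα i ; (inj₂ j) → rel-refl α }) t))
        (rel-trans α r (rel-eval α (λ { (inj₁ i) → aα i ; (inj₂ j) → rel-refl α }) t))
    , rel-eval β (λ { (inj₁ i) → rel-refl β ; (inj₂ j) → bβ j }) t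

-- The image of `Transfer` along `π` is compatible, and reflexive thanks to `s`; it respects rows
-- because `δ` is pulled back along `π`. So `Transfer-greatest` applies.
Cent-surjective : {A B : Algebra 𝒮 ℓ} (π : Hom A B) (s : Algebra.Carrier B → Algebra.Carrier A) →
  (∀ y → Algebra._≈_ B (map π (s y)) y) → (β δ : Con B) →
  ∀ {x y} → rel (Cent (pull π β) (pull π δ)) x y → rel (Cent β δ) (map π x) (map π y)
Cent-surjective {ℓ = ℓ} {A = A} {B} π s πs β δ {x} {y} r =
  Transfer-greatest β δ T T-refl T-op (λ {P} {Q} → T⊆ {P} {Q})
    {map (diagonal β) (map π x)} {map (diagonal β) (map π y)}
    (map (diagonal β*) x , map (diagonal β*) y , r , (≈.refl , ≈.refl) , (≈.refl , ≈.refl))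
  where
  open Algebra B
  β* = pull π β
  δ* = pull π δ
  Pair  = Algebra.Carrier (pairs β)
  Pair* = Algebra.Carrier (pairs β*)
  Over : Pair* → Pair → Set ℓ
  Over ((x* , y*) , _) ((x , y) , _) = map π x* ≈ x × map π y* ≈ y
  T : Rel Pair ℓ
  T P Q = ∃₂ λ P* Q* → rel (Transfer β* δ*) P* Q* × Over P* P × Over Q* Q
  T-refl : ∀ P → T P P
  T-refl ((x , y) , r) = P* , P* , rel-refl (Transfer β* δ*) {P*} , (πs x , πs y) , (πs x , πs y)
    where
    P* : Pair*
    P* = (s x , s y) , rel-≈ β (≈.sym (πs x)) (≈.sym (πs y)) r
  T-op : ∀ f {Ps Qs} → (∀ i → T (Ps i) (Qs i)) → T (Algebra.op (pairs β) f Ps) (Algebra.op (pairs β) f Qs)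
  T-op f rs = Algebra.op (pairs β*) f (proj₁ ∘ rs) , Algebra.op (pairs β*) f (proj₁ ∘ proj₂ ∘ rs)
    , rel-op (Transfer β* δ*) f (λ i → let (_ , _ , r , _) = rs i in r)
    , ( ≈.trans (map-op π f _) (op-cong f (λ i → let (_ , _ , _ , e , _) = rs i in proj₁ e))
      , ≈.trans (map-op π f _) (op-cong f (λ i → let (_ , _ , _ , e , _) = rs i in proj₂ e)))
    , ( ≈.trans (map-op π f _) (op-cong f (λ i → let (_ , _ , _ , _ , e) = rs i in proj₁ e))
      , ≈.trans (map-op π f _) (op-cong f (λ i → let (_ , _ , _ , _ , e) = rs i in proj₂ e)))
  T⊆ : ∀ {P Q} → T P Q → SameRow β δ P Q
  T⊆ (P* , Q* , r , (e , e′) , (h , h′)) with Transfer⊆ β* δ* {P*} {Q*} r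
  ... | to , from = (λ d → rel-≈ δ h h′ (to (rel-≈ δ (≈.sym e) (≈.sym e′) d)))
                  , (λ d → rel-≈ δ e e′ (from (rel-≈ δ (≈.sym h) (≈.sym h′) d)))

-- Compactness of principal congruences

Pair : ∀ {a} {X : Set a} → X → X → Rel X a
Pair x y v w = v ≡ x × w ≡ y

module _ {A : Algebra 𝒮 ℓ} where
  open Algebra A

  Cg-pair⊑ : ∀ {x y} (γ : Con A) → rel γ x y → Cg (Pair x y) ⊑ γ
  Cg-pair⊑ γ r = Cg-least γ λ { (refl , refl) → r }

  ⋁-finite-mono : {I : Set ℓ} (θ : I → Con A) {is js : List I} →
    (∀ {x y} → Any (λ i → rel (θ i) x y) is → Any (λ i → rel (θ i) x y) js) → ⋁-finite θ is ⊑ ⋁-finite θ js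
  ⋁-finite-mono θ {js = js} h = Cg-least (⋁-finite θ js) (gen ∘ h)

  -- Arities are finite, so a derivation uses finitely many generators.
  ⋁⇒⋁-finite : {I : Set ℓ} (θ : I → Con A) → ∀ {x y} → rel (⋁ θ) x y → ∃ λ is → rel (⋁-finite θ is) x y
  ⋁⇒⋁-finite θ (gen (i , r)) = i ∷ [] , gen (here r)
  ⋁⇒⋁-finite θ (incl r)      = [] , incl r
  ⋁⇒⋁-finite θ (symm r)      = let (is , s) = ⋁⇒⋁-finite θ r in is , symm s
  ⋁⇒⋁-finite θ (trns r s) with ⋁⇒⋁-finite θ r | ⋁⇒⋁-finite θ s
  ... | is , r′ | js , s′ = is ++ js
    , trns (⋁-finite-mono θ Any.++⁺ˡ r′) (⋁-finite-mono θ (Any.++⁺ʳ is) s′)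
  ⋁⇒⋁-finite θ (congr f rs)  = concat (tabulate (proj₁ ∘ finite)) , congr f λ i →
    ⋁-finite-mono θ (λ a → Any.concat⁺ (Any.tabulate⁺ i a)) (proj₂ (finite i))
    where finite = λ i → ⋁⇒⋁-finite θ (rs i)

  Cg-pair-compact : ∀ x y → Compact (Cg (Pair x y))
  Cg-pair-compact x y θ h =
    let (is , r) = ⋁⇒⋁-finite θ (h (gen (refl , refl))) in is , Cg-pair⊑ (⋁-finite θ is) r

-- Term algebras

-- `Term` draws its variables from `Set`, whereas the generators used later include elements of an
-- algebra at level `ℓ`.
data FreeTerm (𝒮 : Signature) (X : Set ℓ) : Set ℓ where
  var : X → FreeTerm 𝒮 X
  app : (f : Op 𝒮) → (Fin (arity 𝒮 f) → FreeTerm 𝒮 X) → FreeTerm 𝒮 X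

module _ (B : Algebra 𝒮 ℓ) {X : Set ℓ} where
  open Algebra B

  value : (X → Carrier) → FreeTerm 𝒮 X → Carrier
  value ρ (var x)    = ρ x
  value ρ (app f ts) = op f (λ i → value ρ (ts i))

hom-value : {A B : Algebra 𝒮 ℓ} (h : Hom A B) {X : Set ℓ} (ρ : X → Algebra.Carrier A) (t : FreeTerm 𝒮 X) →
  Algebra._≈_ B (map h (value A ρ t)) (value B (map h ∘ ρ) t)
hom-value {B = B} h ρ (var x)    = Algebra.≈.refl B
hom-value {B = B} h ρ (app f ts) =
  Algebra.≈.trans B (map-op h f _) (Algebra.op-cong B f (λ i → hom-value h ρ (ts i)))

-- Identifying terms only by the identities of A and B gives an algebra of the
-- variety in which the generators X are as free as maps into A and B can see.
module _ (A B : Algebra 𝒮 ℓ) (X : Set ℓ) (x₀ : X) where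
  private
    module A = Algebra A
    module B = Algebra B

  termAlgebra : Algebra 𝒮 ℓ
  termAlgebra = record
    { Carrier       = FreeTerm 𝒮 X
    ; _≈_           = λ s t → (∀ ρ → value A ρ s A.≈ value A ρ t) × (∀ ρ → value B ρ s B.≈ value B ρ t)
    ; isEquivalence = record
      { refl  = (λ ρ → A.≈.refl) , (λ ρ → B.≈.refl)
      ; sym   = λ (p , q) → (λ ρ → A.≈.sym (p ρ)) , (λ ρ → B.≈.sym (q ρ))
      ; trans = λ (p , q) (p′ , q′) → (λ ρ → A.≈.trans (p ρ) (p′ ρ)) , (λ ρ → B.≈.trans (q ρ) (q′ ρ))
      }
    ; op            = app
    ; op-cong       = λ f rs → (λ ρ → A.op-cong f (λ i → proj₁ (rs i) ρ)) , (λ ρ → B.op-cong f (λ i → proj₂ (rs i) ρ))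
    ; nonempty      = var x₀
    }

  valueA : (X → A.Carrier) → Hom termAlgebra A
  valueA ρ = record { map = value A ρ ; map-cong = λ r → proj₁ r ρ ; map-op = λ f xs → A.≈.refl }

  valueB : (X → B.Carrier) → Hom termAlgebra B
  valueB ρ = record { map = value B ρ ; map-cong = λ r → proj₂ r ρ ; map-op = λ f xs → B.≈.refl }

  termAlgebra-∈ᵥ : {𝒱 : Variety 𝒮 ℓ} → A ∈ᵥ 𝒱 → B ∈ᵥ 𝒱 → termAlgebra ∈ᵥ 𝒱
  termAlgebra-∈ᵥ A∈ B∈ {s} {t} e σ =
      (λ ρ → A.≈.trans (hom-eval (valueA ρ) σ s) (A.≈.trans (A∈ e _) (A.≈.sym (hom-eval (valueA ρ) σ t))))
    , (λ ρ → B.≈.trans (hom-eval (valueB ρ) σ s) (B.≈.trans (B∈ e _) (B.≈.sym (hom-eval (valueB ρ) σ t))))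

-- Finite support of terms

Fin-bound : ∀ {n} (f : Fin n → ℕ) → ∃ λ N → ∀ i → f i ≤ N
Fin-bound {zero}  f = 0 , λ ()
Fin-bound {suc n} f with Fin-bound (f ∘ suc)
... | N , h = f zero ⊔ N , λ { zero → m≤m⊔n (f zero) N ; (suc i) → ≤-trans (h i) (m≤n⊔m (f zero) N) }

module _ (B : Algebra 𝒮 ℓ) {X : Set ℓ} (stage : X → ℕ) where
  open Algebra B

  Agree : ℕ → (ρ σ : X → Carrier) → Set ℓ
  Agree N ρ σ = ∀ x → stage x < N → ρ x ≈ σ x

  -- A stage bounds the support in place of a finite set of variables: comparing stages is
  -- decidable, while equality of generators need not be.
  Supported : ℕ → FreeTerm 𝒮 X → Set ℓ
  Supported N t = ∀ ρ σ → Agree N ρ σ → value B ρ t ≈ value B σ t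

  Supported-mono : ∀ {M N} t → M ≤ N → Supported M t → Supported N t
  Supported-mono t M≤N h ρ σ agree = h ρ σ λ x x<M → agree x (<-≤-trans x<M M≤N)

  support : ∀ t → ∃ λ N → Supported N t
  support (var x)    = suc (stage x) , λ ρ σ agree → agree x ≤-refl
  support (app f ts) with Fin-bound (λ i → proj₁ (support (ts i)))
  ... | N , bound = N , λ ρ σ agree → op-cong f λ i →
    Supported-mono (ts i) (bound i) (proj₂ (support (ts i))) ρ σ agree

-- Centrality in a congruence modular variety

module _ {𝒱 : Variety 𝒮 ℓ} (modular : CongruenceModular 𝒱) where

  -- Gumm's Shifting Lemma.
  shift : {B : Algebra 𝒮 ℓ} → B ∈ᵥ 𝒱 → (φ ψ χ : Con B) → φ ∩ ψ ⊑ χ → ∀ {x y z w} →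
    rel φ x y → rel φ z w → rel ψ x z → rel ψ y w → rel χ x z → rel χ y w
  shift B∈ φ ψ χ h p q r s c =
    -- From y φ x (χ ∩ ψ) z φ w and y ψ w, modularity puts (y , w) in (χ ∩ ψ) ∨ (φ ∩ ψ).
    ∨-least {α = χ ∩ ψ} {φ ∩ ψ} {χ} proj₁ h
      (proj₁ (modular _ B∈ (χ ∩ ψ) φ ψ proj₂)
        (trns (gen (inj₂ (rel-sym φ p))) (trns (gen (inj₁ (c , r))) (gen (inj₂ q))) , s))

  -- Matrices are transposed: `T` relates two α-pairs, taken as rows, when the columns lie in A(β)
  -- and are Ψ-related. The Shifting Lemma then carries `κ` from either row to the other.
  Cent-sym-mono : {B : Algebra 𝒮 ℓ} → B ∈ᵥ 𝒱 → (α β δ κ : Con B) →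
    δ ⊑ κ → α ⊑ Cent β δ → β ⊑ Cent α κ
  Cent-sym-mono {B} B∈ α β δ κ δ⊑κ α⊑ {x} {y} xβy =
    Transfer-greatest α κ T T-refl T-op (λ {P} {Q} r → T-to {P} {Q} r , T-from {P} {Q} r)
      {map (diagonal α) x} {map (diagonal α) y} (xβy , xβy , rel-refl Ψ {(x , y) , xβy})
    where
    open Algebra B
    β∈ = pairs-∈ᵥ β {𝒱} B∈
    Ψ  = Transfer β δ
    η₀ = ker (π₀ β)
    η₁ = ker (π₁ β)

    -- Shifting (x , y) Ψ (x , y′) along `η₁` gives (y , y) Ψ (y , y′). The diagonal pair lies in
    -- `δ`, so y δ y′. `η₁∩Ψ⊑` is the mirror image.
    η₀∩Ψ⊑ : η₀ ∩ Ψ ⊑ pull (π₁ β) κ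
    η₀∩Ψ⊑ {(x , y) , r} {(x′ , y′) , r′} (e , s) = δ⊑κ (proj₁ (Transfer⊆ β δ {yy} {yy′}
      (shift β∈ η₁ η₀ Ψ (λ (p , q) → ≈⇒rel Ψ (q , p)) {(x , y) , r} {yy} {(x′ , y′) , r′} {yy′}
        ≈.refl ≈.refl e ≈.refl s)) (rel-refl δ))
      where
      yy  = map (diagonal β) y
      yy′ = (y , y′) , rel-trans β (rel-sym β r) (rel-≈ β (≈.sym e) ≈.refl r′)

    η₁∩Ψ⊑ : η₁ ∩ Ψ ⊑ pull (π₀ β) κ
    η₁∩Ψ⊑ {(x , y) , r} {(x′ , y′) , r′} (e , s) = rel-sym κ (δ⊑κ (proj₁ (Transfer⊆ β δ {xx} {x′x}
      (shift β∈ η₀ η₁ Ψ (≈⇒rel Ψ) {(x , y) , r} {xx} {(x′ , y′) , r′} {x′x}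
        ≈.refl ≈.refl e ≈.refl s)) (rel-refl δ)))
      where
      xx  = map (diagonal β) x
      x′x = (x′ , x) , rel-trans β r′ (rel-sym β (rel-≈ β ≈.refl e r))

    T : Rel (Algebra.Carrier (pairs α)) ℓ
    T ((p , r) , _) ((q , s) , _) =
      Σ (rel β p q) λ pq → Σ (rel β r s) λ rs → rel Ψ ((p , q) , pq) ((r , s) , rs)

    -- The columns are the diagonal pairs at p and r, so this is the assumption on `α`.
    T-refl : ∀ P → T P P
    T-refl ((p , r) , pr) = rel-refl β , rel-refl β , α⊑ pr

    T-op : ∀ f {Ps Qs} → (∀ i → T (Ps i) (Qs i)) → T (Algebra.op (pairs α) f Ps) (Algebra.op (pairs α) f Qs)
    T-op f ts = rel-op β f (proj₁ ∘ ts) , rel-op β f (proj₁ ∘ proj₂ ∘ ts) , rel-op Ψ f (proj₂ ∘ proj₂ ∘ ts)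

    T-to : ∀ {P Q} → T P Q → rel κ (proj₁ (proj₁ P)) (proj₂ (proj₁ P)) → rel κ (proj₁ (proj₁ Q)) (proj₂ (proj₁ Q))
    T-to {(p , r) , pr} {(q , s) , qs} (pq , rs , ψ) =
      shift β∈ η₀ Ψ (pull (π₁ β) κ) η₀∩Ψ⊑
        {map (diagonal β) p} {(p , q) , pq} {map (diagonal β) r} {(r , s) , rs}
        ≈.refl ≈.refl (α⊑ pr) ψ

    T-from : ∀ {P Q} → T P Q → rel κ (proj₁ (proj₁ Q)) (proj₂ (proj₁ Q)) → rel κ (proj₁ (proj₁ P)) (proj₂ (proj₁ P))
    T-from {(p , r) , pr} {(q , s) , qs} (pq , rs , ψ) =
      shift β∈ η₁ Ψ (pull (π₀ β) κ) η₁∩Ψ⊑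
        {map (diagonal β) q} {(p , q) , pq} {map (diagonal β) s} {(r , s) , rs}
        ≈.refl ≈.refl (α⊑ qs) ψ

  Cent-sym : {B : Algebra 𝒮 ℓ} → B ∈ᵥ 𝒱 → (α β δ : Con B) → α ⊑ Cent β δ → β ⊑ Cent α δ
  Cent-sym B∈ α β δ = Cent-sym-mono B∈ α β δ δ id

  -- Images of disjoint congruences centralize each other

  module _ (compact : CompactClosedUnderCommutator 𝒱) {A A′ : Algebra 𝒮 ℓ} (A∈ : A ∈ᵥ 𝒱) (A′∈ : A′ ∈ᵥ 𝒱)
    (u : Hom A A′) where
    private
      module A  = Algebra A
      module A′ = Algebra A′

    -- The commutator K of two principal congruences of the free algebra is
    -- generated by terms in finitely many stages of variables.  The remaining
    -- stages suffice to map onto A′, while on the stages in use the map can be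
    -- made to factor through A, where K collapses.
    push-pair-central : (α β : Con A) → α ∩ β ⊑ Δ → ∀ {a b c d} → rel α a b → rel β c d →
      rel (Cent (Cg (Pair (map u c) (map u d))) Δ) (map u a) (map u b)
    push-pair-central α β disjoint {a} {b} {c} {d} aαb cβd =
      -- In `F`, it suffices by symmetry that `pull π φ` lies in `Cent X κ`. That congruence
      -- contains `κ`, and the generator of `φ` lifts to the pair (z , w) of `Y`.
      Cent-surjective π s (λ _ → section) φ Δ
        (Cent-sym F∈ (pull π φ) X κ
          (correspondence π s (λ _ → section) (Cent X κ) (⊑Cent X κ κ λ (_ , r) → ∨-least {α = κ} {κ} {κ} id id r)
            λ { (refl , refl) → z , w , Y⊑ (gen (refl , refl)) , A′.≈.refl , A′.≈.refl })
          (gen (refl , refl)))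
      where
      Gens : Set ℓ
      Gens = Fin 4 ⊎ (A′.Carrier × ℕ)
      stage : Gens → ℕ
      stage (inj₁ _)       = 0
      stage (inj₂ (_ , n)) = n
      F  = termAlgebra A A′ Gens (inj₁ zero)
      F∈ = termAlgebra-∈ᵥ A A′ Gens (inj₁ zero) {𝒱} A∈ A′∈
      x = FreeTerm.var {𝒮 = 𝒮} {X = Gens} (inj₁ zero)
      y = FreeTerm.var {𝒮 = 𝒮} {X = Gens} (inj₁ (suc zero))
      z = FreeTerm.var {𝒮 = 𝒮} {X = Gens} (inj₁ (suc (suc zero)))
      w = FreeTerm.var {𝒮 = 𝒮} {X = Gens} (inj₁ (suc (suc (suc zero))))
      X Y K : Con F
      X = Cg (Pair x y)
      Y = Cg (Pair z w)
      K = [ X , Y ]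

      ε-env : Gens → A.Carrier
      ε-env (inj₁ i) = Vec.lookup (a Vec.∷ b Vec.∷ c Vec.∷ d Vec.∷ Vec.[]) i
      -- A default value, repeated through `u` by `π-env` on the stages below `N`.
      ε-env (inj₂ _) = a
      ε : Hom F A
      ε = valueA A A′ Gens (inj₁ zero) ε-env
      K⊑kerε : K ⊑ ker ε
      K⊑kerε r with commutator⊑∩ X Y r
      ... | r₁ , r₂ = disjoint (Cg-pair⊑ (pull ε α) aαb r₁ , Cg-pair⊑ (pull ε β) cβd r₂)

      K-below : Lift ℓ ℕ → Con F
      K-below (lift N) = Cg λ s t → rel K s t × Supported A′ stage N s × Supported A′ stage N t

      K⊑⋁ : K ⊑ ⋁ K-below
      K⊑⋁ {s} {t} r with support A′ stage s | support A′ stage t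
      ... | M , hs | N , ht = gen (lift (M ⊔ N) , gen (r
        , Supported-mono A′ stage s (m≤m⊔n M N) hs , Supported-mono A′ stage t (m≤n⊔m M N) ht))

      finite : ∃ λ Ns → K ⊑ ⋁-finite K-below Ns
      finite = compact F F∈ X Y (Cg-pair-compact x y) (Cg-pair-compact z w) K-below K⊑⋁

      N : ℕ
      N = foldr (λ (lift n) m → n ⊔ m) 0 (proj₁ finite)

      π-env : Gens → A′.Carrier
      π-env (inj₁ i)       = map u (ε-env (inj₁ i))
      -- Below stage `N` this copies `u` after `ε`; from stage `N` on, every element of A′ has its
      -- own variable. `s` uses `N`, the first free stage.
      π-env (inj₂ (e , n)) with n <? N
      ... | yes _ = map u a
      ... | no  _ = e
      π : Hom F A′
      π = valueB A A′ Gens (inj₁ zero) π-env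
      s : A′.Carrier → FreeTerm 𝒮 Gens
      s e = var (inj₂ (e , N))
      section : ∀ {e} → π-env (inj₂ (e , N)) A′.≈ e
      section with N <? N
      ... | yes N<N = ⊥-elim (<-irrefl refl N<N)
      ... | no  _   = A′.≈.refl
      κ : Con F
      κ = ker π
      φ : Con A′
      φ = Cg (Pair (map u c) (map u d))

      agree : Agree A′ stage N π-env (map u ∘ ε-env)
      agree (inj₁ i) _ = A′.≈.refl
      agree (inj₂ (e , n)) n<N with n <? N
      ... | yes _  = A′.≈.refl
      ... | no n≮N = ⊥-elim (n≮N n<N)

      factors : ∀ {n t} → n ≤ N → Supported A′ stage n t → value A′ π-env t A′.≈ map u (value A ε-env t)
      factors {t = t} n≤N h = A′.≈.trans (Supported-mono A′ stage t n≤N h _ _ agree) (A′.≈.sym (hom-value u ε-env t))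

      K-below⊑κ : ∀ {n} → n ≤ N → K-below (lift n) ⊑ κ
      K-below⊑κ n≤N = Cg-least κ λ {s} {t} (r , hs , ht) →
        A′.≈.trans (factors {t = s} n≤N hs) (A′.≈.trans (map-cong u (K⊑kerε r)) (A′.≈.sym (factors {t = t} n≤N ht)))

      any-below : ∀ ns → foldr (λ (lift n) m → n ⊔ m) 0 ns ≤ N →
        ∀ {s t} → Any (λ n → rel (K-below n) s t) ns → rel κ s t
      any-below (lift n ∷ ns) h (here r)  = K-below⊑κ (≤-trans (m≤m⊔n n _) h) r
      any-below (lift n ∷ ns) h (there r) = any-below ns (≤-trans (m≤n⊔m n _) h) r

      K⊑κ : K ⊑ κ
      K⊑κ r = Cg-least κ (any-below (proj₁ finite) ≤-refl) (proj₂ finite r)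

      Y⊑ : Y ⊑ Cent X κ
      Y⊑ = Cent-sym-mono F∈ X Y K κ K⊑κ (Centralizes⇒⊑Cent X Y K (commutator-centralizes X Y))

    push-central : (α β : Con A) → α ∩ β ⊑ Δ → push u α ⊑ Cent (push u β) Δ
    push-central α β disjoint = Cg-least (Cent (push u β) Δ) λ { {v} {w} (a , b , aαb , v≈ , w≈) →
      rel-≈ (Cent (push u β) Δ) (A′.≈.sym v≈) (A′.≈.sym w≈)
        (Cent-sym A′∈ (push u β) (Cg (Pair (map u a) (map u b))) Δ
          (Cg-least (Cent (Cg (Pair (map u a) (map u b))) Δ) λ { (c , d , cβd , v≈ , w≈) →
            rel-≈ (Cent (Cg (Pair (map u a) (map u b))) Δ) (A′.≈.sym v≈) (A′.≈.sym w≈)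
              (Cent-sym A′∈ (Cg (Pair (map u a) (map u b))) (Cg (Pair (map u c) (map u d))) Δ
                (Cg-pair⊑ (Cent (Cg (Pair (map u c) (map u d))) Δ) (push-pair-central α β disjoint aαb cβd))
                (gen (refl , refl))) })
          (gen (refl , refl))) }

-- Semidegeneracy and complements

isComplement : {B : Algebra 𝒮 ℓ} {α β : Con B} → α ∩ β ⊑ Δ → ∇ ⊑ α ∨ β → IsComplement α β
isComplement {α = α} {β} d c = (d , λ r → ≈⇒rel α r , ≈⇒rel β r) , (λ _ → lift tt) , c

IsComplement-sym : {B : Algebra 𝒮 ℓ} {α β : Con B} → IsComplement α β → IsComplement β α
IsComplement-sym {α = α} {β} ((d , _) , (_ , c)) = isComplement {α = β} {α} (λ (b , a) → d (a , b))
  (λ r → ∨-least {α = α} {β} {β ∨ α} (gen ∘ inj₂) (gen ∘ inj₁) (c r))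

module _ {𝒱 : Variety 𝒮 ℓ} (semidegenerate : Semidegenerate 𝒱) where

  -- The diagonal becomes a one-element subalgebra of A(γ) modulo Transfer γ δ.
  ∇⊑Cent⇒⊑ : {B : Algebra 𝒮 ℓ} → B ∈ᵥ 𝒱 → (γ δ : Con B) → ∇ ⊑ Cent γ δ → γ ⊑ δ
  ∇⊑Cent⇒⊑ {B} B∈ γ δ total {x} {y} r =
    proj₁ (Transfer⊆ γ δ {dg x} {(x , y) , r}
      (semidegenerate (quotient (pairs γ) Ψ) (quotient-∈ᵥ {𝒱 = 𝒱} Ψ (pairs-∈ᵥ γ {𝒱} B∈)) S one (dg x) ((x , y) , r)))
      (rel-refl δ)
    where
    open Algebra B
    Ψ  = Transfer γ δ
    dg = map (diagonal γ)
    S : Subuniverse (quotient (pairs γ) Ψ)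
    S = record
      { mem      = λ P → ∃ λ x → rel Ψ P (dg x)
      ; mem-resp = λ {P} {Q} r (x , s) → x , rel-trans Ψ {Q} {P} {dg x} (rel-sym Ψ {P} {Q} r) s
      ; closed   = λ f Ps ms → op f (proj₁ ∘ ms) 
          , rel-trans Ψ {Algebra.op (pairs γ) f Ps} {Algebra.op (pairs γ) f (dg ∘ proj₁ ∘ ms)} {dg (op f (proj₁ ∘ ms))}
              (rel-op Ψ f {Ps} {dg ∘ proj₁ ∘ ms} (proj₂ ∘ ms)) (≈⇒rel Ψ (≈.refl , ≈.refl))
      }
    one : Subuniverse.OneElement S
    one = dg nonempty , (nonempty , rel-refl Ψ {dg nonempty})
      , λ {P} (x , s) → rel-trans Ψ {P} {dg x} {dg nonempty} s (total _)

  -- The image of u is a one-element subalgebra of A′ modulo push u ∇.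
  push-∇ : {A A′ : Algebra 𝒮 ℓ} → A′ ∈ᵥ 𝒱 → (u : Hom A A′) → ∇ ⊑ push u ∇
  push-∇ {A} {A′} A′∈ u _ = semidegenerate (quotient A′ θ) (quotient-∈ᵥ {𝒱 = 𝒱} θ A′∈) S one _ _
    where
    open Algebra A′
    θ = push u ∇
    S : Subuniverse (quotient A′ θ)
    S = record
      { mem      = λ y → ∃ λ a → rel θ y (map u a)
      ; mem-resp = λ r (a , s) → a , rel-trans θ (rel-sym θ r) s
      ; closed   = λ f ys ms → Algebra.op A f (proj₁ ∘ ms)
          , rel-trans θ (rel-op θ f (proj₂ ∘ ms)) (≈⇒rel θ (≈.sym (map-op u f _)))
      }
    a₀ = Algebra.nonempty A
    one : Subuniverse.OneElement S
    one = map u a₀ , (a₀ , rel-refl θ)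
      , λ (a , s) → rel-trans θ s (gen (a , a₀ , lift tt , ≈.refl , ≈.refl))

  module _ (modular : CongruenceModular 𝒱) where

    ∇⊑∨⇒⊑ : {B : Algebra 𝒮 ℓ} → B ∈ᵥ 𝒱 → (α β γ : Con B) → ∇ ⊑ α ∨ β → γ ⊑ (γ ∩ α) ∨ (γ ∩ β)
    ∇⊑∨⇒⊑ B∈ α β γ cover = ∇⊑Cent⇒⊑ B∈ γ δ λ r →
      ∨-least {α = α} {β} {Cent γ δ} (⊑Cent γ δ α α-part) (⊑Cent γ δ β β-part) (cover r)
      where
      δ = (γ ∩ α) ∨ (γ ∩ β)
      α-part : γ ∩ (α ∨ δ) ⊑ δ
      α-part (g , r) = ∨-least {α = γ ∩ β} {α ∩ γ} {δ} (gen ∘ inj₂) (λ (a , g) → gen (inj₁ (g , a)))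
        (proj₁ (modular _ B∈ (γ ∩ β) α γ proj₁)
          ( ∨-least {α = α} {δ} {(γ ∩ β) ∨ α} (gen ∘ inj₂)
              (∨-least {α = γ ∩ α} {γ ∩ β} {(γ ∩ β) ∨ α} (gen ∘ inj₂ ∘ proj₂) (gen ∘ inj₁)) r
          , g))
      β-part : γ ∩ (β ∨ δ) ⊑ δ
      β-part (g , r) = ∨-least {α = γ ∩ α} {β ∩ γ} {δ} (gen ∘ inj₁) (λ (b , g) → gen (inj₂ (g , b)))
        (proj₁ (modular _ B∈ (γ ∩ α) β γ proj₁)
          ( ∨-least {α = β} {δ} {(γ ∩ α) ∨ β} (gen ∘ inj₂)
              (∨-least {α = γ ∩ α} {γ ∩ β} {(γ ∩ α) ∨ β} (gen ∘ inj₁) (gen ∘ inj₂ ∘ proj₂)) r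
          , g))

    disjoint⇒⊑complement : {B : Algebra 𝒮 ℓ} → B ∈ᵥ 𝒱 → {α β : Con B} → IsComplement α β →
      (γ : Con B) → γ ∩ α ⊑ Δ → γ ⊑ β
    disjoint⇒⊑complement B∈ {α} {β} (_ , _ , c) γ d r =
      ∨-least {α = γ ∩ α} {γ ∩ β} {β} (≈⇒rel β ∘ d) proj₂ (∇⊑∨⇒⊑ B∈ α β γ c r)

    ∩-complement : {B : Algebra 𝒮 ℓ} → B ∈ᵥ 𝒱 → {α₁ β₁ α₂ β₂ : Con B} →
      IsComplement α₁ β₁ → IsComplement α₂ β₂ → IsComplement (α₁ ∩ α₂) (β₁ ∨ β₂)
    ∩-complement B∈ {α₁} {β₁} {α₂} {β₂} ((d₁ , _) , (_ , c₁)) ((d₂ , _) , (_ , c₂)) =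
      isComplement {α = α₁ ∩ α₂} {β₁ ∨ β₂} disjoint cover
      where
      α₁∩[β₁∨β₂]⊑β₂ : α₁ ∩ (β₁ ∨ β₂) ⊑ β₂
      α₁∩[β₁∨β₂]⊑β₂ (a , r) = ∨-least {α = β₂ ∩ α₁} {β₁ ∩ α₁} {β₂} proj₁ (λ (b , a) → ≈⇒rel β₂ (d₁ (a , b)))
        (proj₁ (modular _ B∈ (β₂ ∩ α₁) β₁ α₁ proj₂)
          ( ∨-least {α = β₁} {β₂} {(β₂ ∩ α₁) ∨ β₁} (gen ∘ inj₂)
              (λ b → ∨-least {α = β₂ ∩ α₁} {β₂ ∩ β₁} {(β₂ ∩ α₁) ∨ β₁} (gen ∘ inj₁) (gen ∘ inj₂ ∘ proj₂)
                (∇⊑∨⇒⊑ B∈ α₁ β₁ β₂ c₁ b)) r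
          , a))
      disjoint : (α₁ ∩ α₂) ∩ (β₁ ∨ β₂) ⊑ Δ
      disjoint ((a₁ , a₂) , r) = d₂ (a₂ , α₁∩[β₁∨β₂]⊑β₂ (a₁ , r))
      cover : ∇ ⊑ (α₁ ∩ α₂) ∨ (β₁ ∨ β₂)
      cover r = ∨-least {α = α₁} {β₁} {top}
        (λ a → ∨-least {α = α₁ ∩ α₂} {α₁ ∩ β₂} {top} (gen ∘ inj₁) (gen ∘ inj₂ ∘ gen ∘ inj₂ ∘ proj₂)
          (∇⊑∨⇒⊑ B∈ α₂ β₂ α₁ c₂ a))
        (gen ∘ inj₂ ∘ gen ∘ inj₁) (c₁ r)
        where top = (α₁ ∩ α₂) ∨ (β₁ ∨ β₂)

    module _ (compact : CompactClosedUnderCommutator 𝒱) {A A′ : Algebra 𝒮 ℓ} (A∈ : A ∈ᵥ 𝒱) (A′∈ : A′ ∈ᵥ 𝒱)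
      (u : Hom A A′) where
      open Algebra A′

      push-least : {α : Con A} (β : Con A′) → α ⊑ pull u β → push u α ⊑ β
      push-least β h = Cg-least β λ { (a , b , r , v≈ , w≈) → rel-≈ β (≈.sym v≈) (≈.sym w≈) (h r) }

      ⊑pull-push : {α : Con A} → α ⊑ pull u (push u α)
      ⊑pull-push r = gen (_ , _ , r , ≈.refl , ≈.refl)

      push-mono : {α β : Con A} → α ⊑ β → push u α ⊑ push u β
      push-mono {α} {β} h = push-least {α} (push u β) (⊑pull-push {β} ∘ h)

      push-∨ : {α β : Con A} → push u (α ∨ β) ⊑ push u α ∨ push u β
      push-∨ {α} {β} = push-least {α ∨ β} (push u α ∨ push u β)
        (∨-least {α = α} {β} {pull u (push u α ∨ push u β)}
          (gen ∘ inj₁ ∘ ⊑pull-push {α}) (gen ∘ inj₂ ∘ ⊑pull-push {β}))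

      push-complement : {α β : Con A} → IsComplement α β → IsComplement (push u α) (push u β)
      push-complement {α} {β} ((d , _) , (_ , c)) =
        isComplement {α = θ} {φ} (∇⊑Cent⇒⊑ A′∈ γ Δ λ r →
            ∨-least {α = θ} {φ} {Cent γ Δ}
              (Cent-sym modular A′∈ γ θ Δ (φ⊑ ∘ proj₂)) (Cent-sym modular A′∈ γ φ Δ (θ⊑ ∘ proj₁)) (cover r))
          cover
        where
        θ = push u α
        φ = push u β
        γ = θ ∩ φ
        θ⊑ : θ ⊑ Cent φ Δ
        θ⊑ = push-central modular compact A∈ A′∈ u α β d
        φ⊑ : φ ⊑ Cent θ Δ
        φ⊑ = Cent-sym modular A′∈ θ φ Δ θ⊑
        cover : ∇ ⊑ θ ∨ φ
        cover r = push-∨ {α} {β} (push-mono {∇} {α ∨ β} c (push-∇ A′∈ u r))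

      push-∩ : {α₁ β₁ α₂ β₂ : Con A} → IsComplement α₁ β₁ → IsComplement α₂ β₂ →
        push u α₁ ∩ push u α₂ ⊑ push u (α₁ ∩ α₂)
      push-∩ {α₁} {β₁} {α₂} {β₂} i₁ i₂ =
        disjoint⇒⊑complement A′∈ {push u (β₁ ∨ β₂)} {push u (α₁ ∩ α₂)}
          (IsComplement-sym {α = push u (α₁ ∩ α₂)} {push u (β₁ ∨ β₂)}
            (push-complement {α₁ ∩ α₂} {β₁ ∨ β₂} (∩-complement A∈ {α₁} {β₁} {α₂} {β₂} i₁ i₂)))
          (push u α₁ ∩ push u α₂)
          λ (r , s) → proj₁ (proj₁ (∩-complement A′∈ {push u α₁} {push u β₁} {push u α₂} {push u β₂}
            (push-complement {α₁} {β₁} i₁) (push-complement {α₂} {β₂} i₂))) (r , push-∨ {β₁} {β₂} s)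

      module Orthogonalization {I : Set} (before : I → List I)
        (before-irrefl : ∀ {i} → ¬ (i ∈ˡ before i))
        (before-total : ∀ {i j} → ¬ (i ≡ j) → i ∈ˡ before j ⊎ j ∈ˡ before i)
        (lifts : LiftsBooleanCongruences u)
        (Ω′ : ConSubset A′ p) (Ω′⊆ : Ω′ ⊆ B[Con A′ ]) (enum : Bijection (setoid I) (ConSubset.Elements Ω′))
        (Ω′-orthogonal : Orthogonal Ω′) where
        open Bijection enum using (to; injective; surjective)

        private
          β : I → Con A′
          β = proj₁ ∘ to
          lifted : ∀ i → ∃ λ α → Complemented α × β i ≐ push u α
          lifted i = Equivalence.to (lifts (β i)) (Ω′⊆ (proj₂ (to i)))
          α ᾱ : I → Con A
          α = proj₁ ∘ lifted
          ᾱ i = proj₁ (proj₁ (proj₂ (lifted i)))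
          α-complement : ∀ i → IsComplement (α i) (ᾱ i)
          α-complement i = proj₂ (proj₁ (proj₂ (lifted i)))
          β≐push-α : ∀ i → β i ≐ push u (α i)
          β≐push-α i = proj₂ (proj₂ (lifted i))

          ᾱ-complement : ∀ i → IsComplement (ᾱ i) (α i)
          ᾱ-complement i = IsComplement-sym {α = α i} {ᾱ i} (α-complement i)

          away : I → List I → Con A
          away i = foldr (λ j θ → ᾱ j ∩ θ) (α i)
          γ : I → Con A
          γ i = away i (before i)

          away-complemented : ∀ i js → Complemented (away i js)
          away-complemented i []       = ᾱ i , α-complement i
          away-complemented i (j ∷ js) with away-complemented i js
          ... | θ , c = α j ∨ θ , ∩-complement A∈ {ᾱ j} {α j} {away i js} {θ} (ᾱ-complement j) c

          away⊑α : ∀ i js → away i js ⊑ α i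
          away⊑α i []       r       = r
          away⊑α i (j ∷ js) (_ , r) = away⊑α i js r

          away⊑ᾱ : ∀ i {j} js → j ∈ˡ js → away i js ⊑ ᾱ j
          away⊑ᾱ i (j ∷ js) (here refl) (r , _) = r
          away⊑ᾱ i (j ∷ js) (there j∈)  (_ , r) = away⊑ᾱ i js j∈ r

          β⊑push-away : ∀ i js → ¬ (i ∈ˡ js) → β i ⊑ push u (away i js)
          β⊑push-away i []       _  = proj₁ (β≐push-α i)
          β⊑push-away i (j ∷ js) i∉ r = push-∩ {ᾱ j} {α j} {away i js} {proj₁ (away-complemented i js)}
            (ᾱ-complement j) (proj₂ (away-complemented i js))
            ( disjoint⇒⊑complement A′∈ {push u (α j)} {push u (ᾱ j)} (push-complement {α j} {ᾱ j} (α-complement j)) (β i)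
                (λ (p , q) → proj₁ (Ω′-orthogonal (proj₂ (to i)) (proj₂ (to j)) (λ e → i∉ (here (injective e))))
                  (p , proj₂ (β≐push-α j) q)) r
            , β⊑push-away i js (i∉ ∘ there) r)

          β≐push-γ : ∀ i → β i ≐ push u (γ i)
          β≐push-γ i = β⊑push-away i (before i) before-irrefl
                     , proj₂ (β≐push-α i) ∘ push-mono {γ i} {α i} (away⊑α i (before i))

          before-disjoint : ∀ {i j} → i ∈ˡ before j → γ i ∩ γ j ⊑ Δ
          before-disjoint {i} {j} i∈ (r , s) =
            proj₁ (proj₁ (α-complement i)) (away⊑α i (before i) r , away⊑ᾱ j (before j) i∈ s)

          γ-disjoint : ∀ {i j} → ¬ (i ≡ j) → γ i ∩ γ j ⊑ Δ
          γ-disjoint i≢j (r , s) with before-total i≢j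
          ... | inj₁ i∈ = before-disjoint i∈ (r , s)
          ... | inj₂ j∈ = before-disjoint j∈ (s , r)

          module ≐ {B : Algebra 𝒮 ℓ} = IsEquivalence (≐-isEquivalence {A = B})

          push-cong : {α β : Con A} → α ≐ β → push u α ≐ push u β
          push-cong {α} {β} (f , g) = push-mono {α} {β} f , push-mono {β} {α} g

          γ-injective : ∀ {i j} → γ i ≐ γ j → i ≡ j
          γ-injective {i} {j} e = injective
            (≐.trans {i = β i} {push u (γ i)} {β j} (β≐push-γ i)
              (≐.trans {i = push u (γ i)} {push u (γ j)} {β j} (push-cong {γ i} {γ j} e)
                (≐.sym {x = β j} {push u (γ j)} (β≐push-γ j))))

        orthogonalization : ConSubset A ℓ
        orthogonalization = record
          { mem      = λ θ → ∃ λ i → θ ≐ γ i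
          ; mem-resp = λ {θ} {φ} e (i , h) → i , ≐.trans {i = φ} {θ} {γ i} (≐.sym {x = θ} {φ} e) h
          }

        orthogonalization⊆ : orthogonalization ⊆ B[Con A ]
        orthogonalization⊆ {θ} (i , e) = ConSubset.mem-resp B[Con A ] {γ i} {θ}
          (≐.sym {x = θ} {γ i} e) (away-complemented i (before i))

        orthogonalization-enum : Bijection (setoid I) (ConSubset.Elements orthogonalization)
        orthogonalization-enum = record
          { to        = λ i → γ i , i , ≐.refl {x = γ i}
          ; cong      = λ { {i} refl → ≐.refl {x = γ i} }
          ; bijective = γ-injective , λ (θ , i , e) → i , λ { refl → ≐.sym {x = θ} {γ i} e }
          }

        orthogonalization-orthogonal : Orthogonal orthogonalization
        orthogonalization-orthogonal {θ} {φ} (i , e) (j , h) θ≢φ =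
            (λ (r , s) → γ-disjoint
              (λ { refl → θ≢φ (≐.trans {i = θ} {γ i} {φ} e (≐.sym {x = φ} {γ i} h)) })
              (proj₁ e r , proj₁ h s))
          , λ r → ≈⇒rel θ r , ≈⇒rel φ r

        orthogonalization-lifts : Lifts u Ω′ orthogonalization
        orthogonalization-lifts θ = mk⇔ forth back
          where
          forth : θ ∈ Ω′ → ∃ λ φ → φ ∈ orthogonalization × θ ≐ push u φ
          forth m with surjective (θ , m)
          ... | i , h = γ i , (i , ≐.refl {x = γ i})
            , ≐.trans {i = θ} {β i} {push u (γ i)} (≐.sym {x = β i} {θ} (h refl)) (β≐push-γ i)
          back : (∃ λ φ → φ ∈ orthogonalization × θ ≐ push u φ) → θ ∈ Ω′
          back (φ , (i , e) , h) = ConSubset.mem-resp Ω′ {β i} {θ}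
            (≐.trans {i = β i} {push u (γ i)} {θ} (β≐push-γ i)
              (≐.trans {i = push u (γ i)} {push u φ} {θ} (push-cong {γ i} {φ} (≐.sym {x = φ} {γ i} e))
                (≐.sym {x = θ} {push u φ} h)))
            (proj₂ (to i))

theorem7p1 : ∀ {ℓ p : Level} (𝒮 : Signature) (𝒱 : Variety 𝒮 ℓ) →
    CongruenceModular 𝒱 →
    Semidegenerate 𝒱 →
    CompactClosedUnderCommutator 𝒱 →
    (A A′ : Algebra 𝒮 ℓ) → A ∈ᵥ 𝒱 → A′ ∈ᵥ 𝒱 →
    (u : Hom A A′) →
    LiftsBooleanCongruences u →
    (Ω′ : ConSubset A′ p) → Ω′ ⊆ B[Con A′ ] → Countable Ω′ → Orthogonal Ω′ →
    Σ (ConSubset A ℓ) (λ Ω → Ω ⊆ B[Con A ] × Countable Ω × Orthogonal Ω × Lifts u Ω′ Ω)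
theorem7p1 {ℓ} 𝒮 𝒱 modular semidegenerate compact A A′ A∈ A′∈ u lifts Ω′ Ω′⊆ countable orthogonal =
  case countable
  where
  Goal : Set _
  Goal = Σ (ConSubset A ℓ) (λ Ω → Ω ⊆ B[Con A ] × Countable Ω × Orthogonal Ω × Lifts u Ω′ Ω)

  from-enum : {I : Set} (before : I → List I) → (∀ {i} → ¬ (i ∈ˡ before i)) →
    (∀ {i j} → ¬ (i ≡ j) → i ∈ˡ before j ⊎ j ∈ˡ before i) →
    (∀ {Ω : ConSubset A ℓ} → Bijection (setoid I) (ConSubset.Elements Ω) → Countable Ω) →
    Bijection (setoid I) (ConSubset.Elements Ω′) → Goal
  from-enum before irrefl total count enum =
      O.orthogonalization , (λ {θ} → O.orthogonalization⊆ {θ}) , count {O.orthogonalization} O.orthogonalization-enum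
    , (λ {θ} {φ} → O.orthogonalization-orthogonal {θ} {φ}) , O.orthogonalization-lifts
    where
    module O = Orthogonalization semidegenerate modular compact A∈ A′∈ u
      before irrefl total lifts Ω′ Ω′⊆ enum orthogonal

  case : Countable Ω′ → Goal
  case (inj₁ (n , enum)) = from-enum (λ i → filter (Fin._<? i) (allFin n))
    (λ {i} i∈ → <-irrefl refl (proj₂ (∈-filter⁻ (Fin._<? i) {xs = allFin n} i∈)))
    total (λ e → inj₁ (n , e)) enum
    where
    total : ∀ {i j : Fin n} → ¬ (i ≡ j) → i ∈ˡ filter (Fin._<? j) (allFin n) ⊎ j ∈ˡ filter (Fin._<? i) (allFin n)
    total {i} {j} i≢j with Fin.<-cmp i j
    ... | tri< i<j _ _ = inj₁ (∈-filter⁺ (Fin._<? j) (∈-allFin i) i<j)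
    ... | tri≈ _ eq _  = ⊥-elim (i≢j eq)
    ... | tri> _ _ j<i = inj₂ (∈-filter⁺ (Fin._<? i) (∈-allFin j) j<i)
  case (inj₂ enum) = from-enum upTo (λ i∈ → <-irrefl refl (∈-upTo⁻ i∈)) total inj₂ enum
    where
    total : ∀ {i j} → ¬ (i ≡ j) → i ∈ˡ upTo j ⊎ j ∈ˡ upTo i
    total {i} {j} i≢j with <-cmp i j
    ... | tri< i<j _ _ = inj₁ (∈-upTo⁺ i<j)
    ... | tri≈ _ eq _  = ⊥-elim (i≢j eq)
    ... | tri> _ _ j<i = inj₂ (∈-upTo⁺ j<i)
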